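{- For all integers $t \ge 11$, every edge-coloured graph $G$ on $n$ vertices with $\Delta^{\mathrm{mon}}(G) \le t$ can be edge-decomposed into $\lfloor t n/2 \rfloor$ rainbow matchings (some of which may be empty).
   Context: Graphs are simple and finite. An edge-coloured graph is a graph in which each edge is assigned a colour (not necessarily properly). A matching is rainbow if all its edges have distinct colours. $\Delta^{\mathrm{mon}}(G)$ denotes the largest maximum degree among the monochromatic subgraphs of $G$, i.e. the maximum over vertices $v$ and colours $c$ of the number of edges of colour $c$ incident with $v$. An edge-decomposition into matchings is a partition of $E(G)$ into (edge-disjoint) matchings. -}

module Defs where

open import Data.Nat using (ℕ; _≤_)
open import Data.Bool using (Bool; true; false; T)
open import Data.Fin using (Fin)
open import Data.List using (List; length; filterᵇ)
open import Data.List using (allFin)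
open import Data.Nat using (_≡ᵇ_)
open import Data.Bool using (_∧_)
open import Data.Product using (_×_)
open import Data.Sum using (_⊎_)
open import Relation.Binary.PropositionalEquality using (_≡_; _≢_)
open import Relation.Nullary using (¬_)

record SimpleGraph (n : ℕ) : Set where
  field
    adj   : Fin n → Fin n → Bool
    sym   : ∀ u v → adj u v ≡ adj v u
    irrefl : ∀ v → adj v v ≡ false

open SimpleGraph public

Edge : {n : ℕ} → SimpleGraph n → Fin n → Fin n → Set
Edge G u v = T (adj G u v)

-- An edge colouring with colours in ℕ (arbitrary, not necessarily proper):
-- a function on ordered pairs which is symmetric on edges, so that the
-- colour of the edge {u,v} is well-defined.
record EdgeColouring {n : ℕ} (G : SimpleGraph n) : Set where
  field
    col    : Fin n → Fin n → ℕ
    colSym : ∀ u v → Edge G u v → col u v ≡ col v u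

open EdgeColouring public

monDeg : {n : ℕ} (G : SimpleGraph n) → EdgeColouring G → Fin n → ℕ → ℕ
monDeg G χ v c = length (filterᵇ (λ w → adj G v w ∧ (col χ v w ≡ᵇ c)) (allFin _))

MonDegAtMost : {n : ℕ} (G : SimpleGraph n) → EdgeColouring G → ℕ → Set
MonDegAtMost G χ t = ∀ v c → monDeg G χ v c ≤ t

SameEdge : {n : ℕ} → Fin n → Fin n → Fin n → Fin n → Set
SameEdge u v x y = (u ≡ x × v ≡ y) ⊎ (u ≡ y × v ≡ x)

record RainbowMatchingDecomposition {n : ℕ} (G : SimpleGraph n)
         (χ : EdgeColouring G) (k : ℕ) : Set where
  field
    cls    : Fin n → Fin n → Fin k
    clsSym : ∀ u v → Edge G u v → cls u v ≡ cls v u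
    rainbowMatching : ∀ u v x y → Edge G u v → Edge G x y →
      cls u v ≡ cls x y → ¬ SameEdge u v x y →
      (u ≢ x × u ≢ y × v ≢ x × v ≢ y) × col χ u v ≢ col χ x y

{-# OPTIONS --safe #-}
-- The edges are inserted one at a time into k = ⌊tn/2⌋ matchings. An edge of colour c meets at most
-- 2n inserted edges, so inserting it is immediate unless c is large: k < 2n + |E_c|. All edges of
-- large colours are inserted first. There are few large colours, about n/(t-4), so at that stage
-- every matching is small and touches few edges of colour c. Since |E_c| ≤ k, some matching M_b has
-- no edge of colour c yet. Some matching M_i contains no edge meeting the new edge, and no edge
-- of colour c that is blocked from M_b; the edge of colour c in M_i, if any, is moved to M_b, and the
-- new edge takes its place.

module Submission where

open import Defs hiding (sym)
open import Data.Bool using (_∧_; T; if_then_else_)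
open import Data.Bool.Properties using (T-∧; T?)
open import Data.Fin as Fin using (Fin)
import Data.Fin.Properties as Fin
open import Data.List using (List; []; _∷_; _++_; [_]; map; length; filter; filterᵇ; concatMap; cartesianProduct; deduplicate; allFin)
open import Data.List.Properties using (length-map; length-++; length-++-sucʳ; length-tabulate; filter-accept)
open import Data.List.Membership.Propositional using (_∈_; _∉_; find; lose)
open import Data.List.Membership.Propositional.Properties
open import Data.List.Relation.Binary.Disjoint.Propositional using (Disjoint)
open import Data.List.Relation.Binary.Subset.Propositional using (_⊆_)
open import Data.List.Relation.Unary.All as All using ([]; _∷_)
import Data.List.Relation.Unary.All.Properties as All
open import Data.List.Relation.Unary.AllPairs as AllPairs using ([]; _∷_)
import Data.List.Relation.Unary.AllPairs.Properties as AllPairs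
open import Data.List.Relation.Unary.Any as Any using (here; there)
open import Data.List.Relation.Unary.Unique.Propositional using (Unique)
open import Data.List.Relation.Unary.Unique.Propositional.Properties as Unique using (allFin⁺)
open import Data.List.Relation.Unary.Unique.DecPropositional.Properties using (deduplicate-!)
open import Data.Nat as ℕ using (ℕ; zero; suc; _+_; _*_; _/_; _%_; _≤_; _<_; z≤n; s≤s)
open import Data.Nat.DivMod using (m≡m%n+[m/n]*n; m%n<n; m≥n⇒m/n>0; m*n/n≡m; /-monoˡ-≤)
open import Data.Nat.Properties as ℕ using (≤-trans; ≤-reflexive; +-mono-≤; module ≤-Reasoning)
open import Data.Nat.Tactic.RingSolver using (solve-∀)
open import Data.Product using (∃; _×_; _,_; proj₁; proj₂; swap)
open import Data.Product.Properties using (≡-dec)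
open import Data.Sum using (_⊎_; inj₁; inj₂)
open import Function using (_∘_; id; Equivalence)
open import Relation.Binary using (DecidableEquality; Symmetric; tri<; tri≈; tri>) renaming (Decidable to Decidable₂)
open import Relation.Binary.PropositionalEquality using (_≡_; _≢_; refl; sym; trans; cong; subst; ≢-sym)
open import Relation.Nullary using (¬_; yes; no; does; contradiction)
open import Relation.Nullary.Decidable using (¬?; _×-dec_; _⊎-dec_)
open import Relation.Unary using (Decidable)

-- Counting in lists.

private variable
  A B : Set

∈-++-∷⁻ : ∀ {x y : A} ys {zs} → x ∈ ys ++ [ y ] ++ zs → x ≢ y → x ∈ ys ++ zs
∈-++-∷⁻ ys x∈ x≢y with ∈-++⁻ ys x∈
... | inj₁ x∈ys         = ∈-++⁺ˡ x∈ys
... | inj₂ (here x≡y)   = contradiction x≡y x≢y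
... | inj₂ (there x∈zs) = ∈-++⁺ʳ ys x∈zs

-- Deleting one occurrence of `g x` from `ys` leaves a list that still receives the images of the
-- other members. Injectivity is asked on members only, so that maps injective merely on a star or
-- on a matching qualify.
injection-length : {xs : List A} {ys : List B} (g : A → B) → Unique xs →
  (∀ {x y} → x ∈ xs → y ∈ xs → g x ≡ g y → x ≡ y) →
  (∀ {x} → x ∈ xs → g x ∈ ys) → length xs ≤ length ys
injection-length g [] inj into = z≤n
injection-length {xs = x ∷ xs} g (x∉xs ∷ u) inj into with ∈-∃++ (into (here refl))
... | ys , zs , refl = ≤-trans
  (s≤s (injection-length g u (λ p q → inj (there p) (there q)) λ y∈ →
    ∈-++-∷⁻ ys (into (there y∈)) λ eq → All.lookup x∉xs y∈ (inj (here refl) (there y∈) (sym eq))))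
  (≤-reflexive (sym (length-++-sucʳ ys (g x) zs)))

⊆-length : {xs ys : List A} → Unique xs → xs ⊆ ys → length xs ≤ length ys
⊆-length u = injection-length id u (λ _ _ → id)

length-concatMap-≤ : ∀ {b} (f : A → List B) xs → (∀ {x} → x ∈ xs → length (f x) ≤ b) →
  length (concatMap f xs) ≤ length xs * b
length-concatMap-≤ f []       bound = z≤n
length-concatMap-≤ f (x ∷ xs) bound = ≤-trans (≤-reflexive (length-++ (f x)))
  (+-mono-≤ (bound (here refl)) (length-concatMap-≤ f xs (bound ∘ there)))

∃∉ : ∀ {k} (is : List (Fin k)) → length is < k → ∃ λ i → i ∉ is
∃∉ {k} is is<k with All.all? (λ i → Any.any? (i Fin.≟_) is) (allFin k)
... | no ¬all = let i , _ , i∉ = find (All.¬All⇒Any¬ (λ i → Any.any? (i Fin.≟_) is) _ ¬all) in i , i∉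
... | yes all = contradiction
  (≤-trans (≤-reflexive (sym (length-tabulate {n = k} id))) (⊆-length (allFin⁺ k) (All.lookup all)))
  (ℕ.<⇒≱ is<k)

concatMap-length-≥ : ∀ {b} (f : A → List B) xs → (∀ {x} → x ∈ xs → b ≤ 2 * length (f x)) →
  length xs * b ≤ 2 * length (concatMap f xs)
concatMap-length-≥ f []       bound = z≤n
concatMap-length-≥ {b = b} f (x ∷ xs) bound = begin
  b + length xs * b                                 ≤⟨ +-mono-≤ (bound (here refl)) (concatMap-length-≥ f xs (bound ∘ there)) ⟩
  2 * length (f x) + 2 * length (concatMap f xs)    ≡⟨ ℕ.*-distribˡ-+ 2 (length (f x)) _ ⟨
  2 * (length (f x) + length (concatMap f xs))      ≡⟨ cong (2 *_) (length-++ (f x)) ⟨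
  2 * length (concatMap f (x ∷ xs))                 ∎
  where open ≤-Reasoning

-- Arithmetic of the number of matchings.

m<2+2[m/2] : ∀ m → m < 2 + 2 * (m / 2)
m<2+2[m/2] m = begin-strict
  m                      ≡⟨ m≡m%n+[m/n]*n m 2 ⟩
  m % 2 + m / 2 * 2      <⟨ ℕ.+-monoˡ-< _ (m%n<n m 2) ⟩
  2 + m / 2 * 2          ≡⟨ cong (2 +_) (ℕ.*-comm (m / 2) 2) ⟩
  2 + 2 * (m / 2)        ∎
  where open ≤-Reasoning

2m≤n⇒m≤n/2 : ∀ {m n} → 2 * m ≤ n → m ≤ n / 2
2m≤n⇒m≤n/2 {m} {n} 2m≤n = begin
  m          ≡⟨ m*n/n≡m m 2 ⟨
  m * 2 / 2  ≤⟨ /-monoˡ-≤ 2 (≤-trans (≤-reflexive (ℕ.*-comm m 2)) 2m≤n) ⟩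
  n / 2      ∎
  where open ≤-Reasoning

-- Throughout, `t` is written `11 + r`, so that `7 + r` is `t - 4` without truncated subtraction.
4n+1+[t-4]n : ∀ r n → 4 * n + suc ((7 + r) * n) ≡ suc ((11 + r) * n)
4n+1+[t-4]n = solve-∀

-- Doubling absorbs the rounding in `k`: `t n + 1 ≤ 2 (k + 1) ≤ 4 n + 2 m`, and `4 n` cancels.
large-class-bound : ∀ r n m → (11 + r) * n / 2 < 2 * n + m → suc ((7 + r) * n) ≤ 2 * m
large-class-bound r n m k< = ℕ.+-cancelˡ-≤ (4 * n) _ _ (begin
  4 * n + suc ((7 + r) * n)           ≡⟨ 4n+1+[t-4]n r n ⟩
  suc ((11 + r) * n)                  ≤⟨ m<2+2[m/2] ((11 + r) * n) ⟩
  2 + 2 * ((11 + r) * n / 2)          ≡⟨ lemma₂ ((11 + r) * n / 2) ⟩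
  2 * suc ((11 + r) * n / 2)          ≤⟨ ℕ.*-monoʳ-≤ 2 k< ⟩
  2 * (2 * n + m)                     ≡⟨ lemma₃ n m ⟩
  4 * n + 2 * m                       ∎)
  where
  open ≤-Reasoning
  lemma₂ : ∀ k → 2 + 2 * k ≡ 2 * suc k
  lemma₂ = solve-∀
  lemma₃ : ∀ n m → 2 * (2 * n + m) ≡ 4 * n + 2 * m
  lemma₃ = solve-∀

-- With s = t - 4, the hypothesis gives j s ≤ n, and t ≥ 11 enters as s² > 4 s + 17.
swap-room : ∀ r n j → 1 ≤ n → 1 ≤ j → j * suc ((7 + r) * n) ≤ n * n →
  2 * n + j * (2 * (11 + r)) < (11 + r) * n / 2
swap-room r n@(suc _) j@(suc _) _ _ few with ℕ.<-≤-connex (2 * n + j * (2 * (11 + r))) ((11 + r) * n / 2)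
... | inj₁ room = room
-- Without room, `s n ≤ 4 j t + 1`. Multiplying by `s` and using `j s ≤ n` gives `s² n ≤ 4 t n + n`,
-- which is too small.
... | inj₂ k≤ = contradiction (begin-strict
  s * (s * n)                                        ≤⟨ ℕ.*-monoʳ-≤ s sn≤ ⟩
  s * suc (4 * (j * (11 + r)))                       ≡⟨ lemma₁ r j ⟩
  4 * ((11 + r) * (j * s)) + s                       ≤⟨ +-mono-≤ (ℕ.*-monoʳ-≤ 4 (ℕ.*-monoʳ-≤ (11 + r) js≤n)) (≤-trans (ℕ.m≤n*m s j) js≤n) ⟩
  -- The added term is `(s² - 4 t - 1) n` expanded in `r`; its summand `4 n` makes it positive.
  4 * ((11 + r) * n) + n                             <⟨ ℕ.m<m+n _ {r * r * n + 10 * (r * n) + 4 * n} (≤-trans (s≤s z≤n) (ℕ.m≤n+m (4 * n) (r * r * n + 10 * (r * n)))) ⟩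
  4 * ((11 + r) * n) + n + (r * r * n + 10 * (r * n) + 4 * n) ≡⟨ lemma₂ r n ⟩
  s * (s * n)                                        ∎) (ℕ.n≮n _)
  where
  open ≤-Reasoning
  s = 7 + r
  js≤n : j * s ≤ n
  js≤n = ℕ.*-cancelʳ-≤ (j * s) n n (begin
    j * s * n        ≡⟨ ℕ.*-assoc j s n ⟩
    j * (s * n)      ≤⟨ ℕ.*-monoʳ-≤ j (ℕ.n≤1+n (s * n)) ⟩
    j * suc (s * n)  ≤⟨ few ⟩
    n * n            ∎)
  lemma₁ : ∀ r j → (7 + r) * suc (4 * (j * (11 + r))) ≡ 4 * ((11 + r) * (j * (7 + r))) + (7 + r)
  lemma₁ = solve-∀
  lemma₂ : ∀ r n → 4 * ((11 + r) * n) + n + (r * r * n + 10 * (r * n) + 4 * n) ≡ (7 + r) * ((7 + r) * n)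
  lemma₂ = solve-∀
  lemma₃ : ∀ r n j → 2 + 2 * (2 * n + j * (2 * (11 + r))) ≡ 4 * n + suc (suc (4 * (j * (11 + r))))
  lemma₃ = solve-∀
  sn≤ : s * n ≤ suc (4 * (j * (11 + r)))
  sn≤ = ℕ.s≤s⁻¹ (ℕ.+-cancelˡ-≤ (4 * n) _ _ (begin
    4 * n + suc (s * n)                     ≡⟨ 4n+1+[t-4]n r n ⟩
    suc ((11 + r) * n)                      ≤⟨ m<2+2[m/2] ((11 + r) * n) ⟩
    2 + 2 * ((11 + r) * n / 2)              ≤⟨ ℕ.+-monoʳ-≤ 2 (ℕ.*-monoʳ-≤ 2 k≤) ⟩
    2 + 2 * (2 * n + j * (2 * (11 + r)))    ≡⟨ lemma₃ r n j ⟩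
    4 * n + suc (suc (4 * (j * (11 + r))))  ∎))

-- Extending a proper assignment by one element.

module Recolouring {E : Set} (_≟_ : DecidableEquality E)
  {Meets : E → E → Set} (meets? : Decidable₂ Meets) (meets-sym : Symmetric Meets)
  (colour : E → ℕ) where

  private variable
    k : ℕ

  Conflict : E → E → Set
  Conflict p q = Meets p q ⊎ colour p ≡ colour q

  conflict-sym : Symmetric Conflict
  conflict-sym (inj₁ m) = inj₁ (meets-sym m)
  conflict-sym (inj₂ c) = inj₂ (sym c)

  meeting : E → List E → List E
  meeting e = filter (meets? e)

  class : ℕ → List E → List E
  class c = filter λ q → colour q ℕ.≟ c

  -- The fibres of `f` on `L` are rainbow matchings. Values outside `L` are unconstrained, so a
  -- total function can represent a partial assignment.
  Proper : (E → Fin k) → List E → Set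
  Proper f L = ∀ {p q} → p ∈ L → q ∈ L → p ≢ q → Conflict p q → f p ≢ f q

  _[_↦_] : (E → Fin k) → E → Fin k → E → Fin k
  (f [ p ↦ b ]) q = if does (q ≟ p) then b else f q

  ∈-tail : ∀ {x p} {L : List E} → x ∈ p ∷ L → x ≢ p → x ∈ L
  ∈-tail (here x≡p)  x≢p = contradiction x≡p x≢p
  ∈-tail (there x∈L) _   = x∈L

  -- This serves both for a new `p` and for moving a `p` already in `L`; the old value of `p` is
  -- therefore exempt from the hypothesis.
  proper-update : ∀ {f : E → Fin k} {L p b} → Proper f L →
    (∀ {q} → q ∈ L → q ≢ p → Conflict p q → f q ≢ b) → Proper (f [ p ↦ b ]) (p ∷ L)
  proper-update {p = p} proper free {x} {y} x∈ y∈ x≢y xy with x ≟ p | y ≟ p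
  ... | yes refl | yes refl = contradiction refl x≢y
  ... | yes refl | no y≢p   = ≢-sym (free (∈-tail y∈ y≢p) y≢p xy)
  ... | no x≢p   | yes refl = free (∈-tail x∈ x≢p) x≢p (conflict-sym xy)
  ... | no x≢p   | no y≢p   = proper (∈-tail x∈ x≢p) (∈-tail y∈ y≢p) x≢y xy

  -- The indices of edges in conflict with `e` are fewer than `k`, so one index is free.
  insert-greedily : ∀ {f : E → Fin k} {L e} → Proper f L →
    length (meeting e L) + length (class (colour e) L) < k → ∃ λ f′ → Proper f′ (e ∷ L)
  insert-greedily {f = f} {L} {e} proper room = f [ e ↦ i ] , proper-update proper free
    where
    blocked = map f (meeting e L ++ class (colour e) L)
    pick = ∃∉ blocked (ℕ.≤-<-trans
      (≤-reflexive (trans (length-map f (meeting e L ++ _)) (length-++ (meeting e L)))) room)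
    i = proj₁ pick
    free : ∀ {q} → q ∈ L → q ≢ e → Conflict e q → f q ≢ i
    free q∈ _ (inj₁ m) fq≡i = proj₂ pick (subst (_∈ blocked) fq≡i
      (∈-map⁺ f (∈-++⁺ˡ (∈-filter⁺ (meets? e) q∈ m))))
    free q∈ _ (inj₂ c) fq≡i = proj₂ pick (subst (_∈ blocked) fq≡i
      (∈-map⁺ f (∈-++⁺ʳ (meeting e L) (∈-filter⁺ _ q∈ (sym c)))))

  -- The edges of colour `c` that cannot move to matching `b` because they meet one of its edges.
  -- Repetitions are harmless, as only an upper bound on the length is used.
  near : (E → Fin k) → List E → ℕ → Fin k → List E
  near f L c b = concatMap (λ q → meeting q (class c L)) (filter (λ q → f q Fin.≟ b) L)

  -- The index `i` has to avoid only `meeting e L` and `near`, not the whole colour class: the edge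
  -- of colour `c` in matching `i`, if any, is unique and can go to `b`.
  insert-swapping : ∀ {f : E → Fin k} {L e s} → Proper f L → length (class (colour e) L) < k →
    (∀ b → length (near f L (colour e) b) ≤ s) → length (meeting e L) + s < k →
    ∃ λ f′ → Proper f′ (e ∷ L)
  insert-swapping {f = f} {L} {e} proper class<k near≤s room =
    result (Any.any? (λ p → (colour p ℕ.≟ colour e) ×-dec (f p Fin.≟ i)) L)
    where
    c = colour e
    pick-b = ∃∉ (map f (class c L)) (ℕ.≤-<-trans (≤-reflexive (length-map f (class c L))) class<k)
    b = proj₁ pick-b

    b-free : ∀ {q} → q ∈ L → colour q ≡ c → f q ≢ b
    b-free q∈ cq fq≡b = proj₂ pick-b (subst (_∈ map f (class c L)) fq≡b
      (∈-map⁺ f (∈-filter⁺ _ q∈ cq)))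

    blocked = map f (meeting e L ++ near f L c b)
    pick-i = ∃∉ blocked (ℕ.≤-<-trans (≤-trans
      (≤-reflexive (trans (length-map f (meeting e L ++ _)) (length-++ (meeting e L))))
      (ℕ.+-monoʳ-≤ (length (meeting e L)) (near≤s b))) room)
    i = proj₁ pick-i

    i-free : ∀ {q} → q ∈ L → Meets e q → f q ≢ i
    i-free q∈ m fq≡i = proj₂ pick-i (subst (_∈ blocked) fq≡i
      (∈-map⁺ f (∈-++⁺ˡ (∈-filter⁺ (meets? e) q∈ m))))

    i-far : ∀ {p q} → p ∈ L → colour p ≡ c → q ∈ L → f q ≡ b → Meets q p → f p ≢ i
    i-far p∈ cp q∈ fq≡b m fp≡i = proj₂ pick-i (subst (_∈ blocked) fp≡i
      (∈-map⁺ f (∈-++⁺ʳ (meeting e L) (∈-concat⁺′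
        (∈-filter⁺ (meets? _) (∈-filter⁺ _ p∈ cp) m)
        (∈-map⁺ _ (∈-filter⁺ _ q∈ fq≡b))))))

    result : _ → ∃ λ f′ → Proper f′ (e ∷ L)
    result (no none) = f [ e ↦ i ] , proper-update proper free
      where
      free : ∀ {q} → q ∈ L → q ≢ e → Conflict e q → f q ≢ i
      free q∈ _ (inj₁ m)  fq≡i = i-free q∈ m fq≡i
      free q∈ _ (inj₂ eq) fq≡i = none (lose q∈ (sym eq , fq≡i))
    result (yes some) with find some
    ... | p , p∈ , cp , fp≡i = (f [ p ↦ b ]) [ e ↦ i ] , proper-update proper′ free
      where
      proper′ : Proper (f [ p ↦ b ]) L
      proper′ x∈ y∈ = proper-update proper p-free (there x∈) (there y∈)
        where
        p-free : ∀ {q} → q ∈ L → q ≢ p → Conflict p q → f q ≢ b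
        p-free q∈ _ (inj₁ m)  fq≡b = i-far p∈ cp q∈ fq≡b (meets-sym m) fp≡i
        p-free q∈ _ (inj₂ eq) fq≡b = b-free q∈ (trans (sym eq) cp) fq≡b

      free : ∀ {q} → q ∈ L → q ≢ e → Conflict e q → (f [ p ↦ b ]) q ≢ i
      free {q} q∈ _ eq fq≡i with q ≟ p
      -- The moved edge now has value `b`, and `b` differs from `i`: `p` had value `i`, while no
      -- edge of colour `c` had value `b`.
      ... | yes refl = b-free p∈ cp (trans fp≡i (sym fq≡i))
      free q∈ _ (inj₁ m) fq≡i | no _ = i-free q∈ m fq≡i
      -- Otherwise `p` and `q` would be two edges of colour `c` in matching `i` before the swap.
      free q∈ _ (inj₂ eq) fq≡i | no q≢p =
        proper q∈ p∈ q≢p (inj₂ (trans (sym eq) (sym cp))) (trans fq≡i (sym fp≡i))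

-- Edges as increasing pairs, and incidence.

module Edges {n : ℕ} (G : SimpleGraph n) (χ : EdgeColouring G) where

  Pair : Set
  Pair = Fin n × Fin n

  _≟ᴾ_ : DecidableEquality Pair
  _≟ᴾ_ = ≡-dec Fin._≟_ Fin._≟_

  IsEdge : Pair → Set
  IsEdge (u , v) = u Fin.< v × Edge G u v

  isEdge? : Decidable IsEdge
  isEdge? (u , v) = (u Fin.<? v) ×-dec T? (adj G u v)

  Incident : Fin n → Pair → Set
  Incident w (x , y) = w ≡ x ⊎ w ≡ y

  incident? : Decidable₂ Incident
  incident? w (x , y) = (w Fin.≟ x) ⊎-dec (w Fin.≟ y)

  Meets : Pair → Pair → Set
  Meets (u , v) q = Incident u q ⊎ Incident v q

  meets? : Decidable₂ Meets
  meets? (u , v) q = incident? u q ⊎-dec incident? v q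

  meets-at : ∀ {w p q} → Incident w p → Incident w q → Meets p q
  meets-at (inj₁ refl) w∈q = inj₁ w∈q
  meets-at (inj₂ refl) w∈q = inj₂ w∈q

  meets-sym : Symmetric Meets
  meets-sym (inj₁ u∈q) = meets-at u∈q (inj₁ refl)
  meets-sym (inj₂ v∈q) = meets-at v∈q (inj₂ refl)

  colour : Pair → ℕ
  colour (u , v) = col χ u v

  star : Fin n → List Pair → List Pair
  star w = filter (incident? w)

  other : Fin n → Pair → Fin n
  other w (x , y) with w Fin.≟ x
  ... | yes _ = y
  ... | no  _ = x

  other-spec : ∀ {w e} → Incident w e → e ≡ (w , other w e) ⊎ e ≡ (other w e , w)
  other-spec {w} {x , y} w∈e with w Fin.≟ x
  other-spec w∈e         | yes refl = inj₁ refl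
  other-spec (inj₁ w≡x)  | no w≢x   = contradiction w≡x w≢x
  other-spec (inj₂ refl) | no w≢x   = inj₂ refl

  ordered : ∀ {e x y} → IsEdge e → e ≡ (x , y) → x Fin.< y
  ordered (x<y , _) refl = x<y

  -- If `w` were the smaller end of one edge and the larger end of the other, the common opposite
  -- end would lie both above and below `w`.
  other-injective : ∀ {w e e′} → IsEdge e → IsEdge e′ → Incident w e → Incident w e′ →
    other w e ≡ other w e′ → e ≡ e′
  other-injective {w} edge edge′ w∈e w∈e′ eq with other-spec w∈e | other-spec w∈e′
  ... | inj₁ p | inj₁ q = trans p (trans (cong (w ,_) eq) (sym q))
  ... | inj₂ p | inj₂ q = trans p (trans (cong (_, w) eq) (sym q))
  ... | inj₁ p | inj₂ q = contradiction (ordered edge′ q) (ℕ.<-asym (subst (w Fin.<_) eq (ordered edge p)))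
  ... | inj₂ p | inj₁ q = contradiction (ordered edge′ q) (ℕ.<-asym (subst (Fin._< w) eq (ordered edge p)))

  other-adjacent : ∀ {w e} → IsEdge e → Incident w e → Edge G w (other w e) × col χ w (other w e) ≡ colour e
  other-adjacent {w} {e} (_ , edge) w∈e with other w e | other-spec w∈e
  ... | z | inj₁ refl = edge , refl
  ... | z | inj₂ refl = subst T (SimpleGraph.sym G z w) edge , sym (colSym χ z w edge)

  -- The list measured by `monDeg`, so the degree hypothesis bounds its length by definition.
  neighbours : Fin n → ℕ → List (Fin n)
  neighbours v c = filterᵇ (λ w → adj G v w ∧ (col χ v w ℕ.≡ᵇ c)) (allFin n)

  ∈-neighbours : ∀ {v w c} → Edge G v w → col χ v w ≡ c → w ∈ neighbours v c
  ∈-neighbours {v} {w} {c} vw eq = ∈-filter⁺ (λ w → T? (adj G v w ∧ (col χ v w ℕ.≡ᵇ c))) (∈-allFin w)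
    (Equivalence.from T-∧ (vw , ℕ.≡⇒≡ᵇ (col χ v w) c eq))

  open Recolouring _≟ᴾ_ meets? (λ {p} {q} → meets-sym {p} {q}) colour public

  -- The edge list and the sizes of stars.

  E : List Pair
  E = filter isEdge? (cartesianProduct (allFin n) (allFin n))

  E-unique : Unique E
  E-unique = Unique.filter⁺ isEdge? (Unique.cartesianProduct⁺ (allFin⁺ n) (allFin⁺ n))

  ∈-E⁺ : ∀ {e} → IsEdge e → e ∈ E
  ∈-E⁺ = ∈-filter⁺ isEdge? (∈-cartesianProduct⁺ (∈-allFin _) (∈-allFin _))

  ∈-E⁻ : ∀ {e} → e ∈ E → IsEdge e
  ∈-E⁻ e∈ = proj₂ (∈-filter⁻ isEdge? {xs = cartesianProduct (allFin n) (allFin n)} e∈)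

  -- The map `other w` injects the star into `ys`, which is later either all vertices or the
  -- neighbours of `w` in one colour.
  star-length : ∀ {L w} {ys : List (Fin n)} → Unique L → L ⊆ E →
    (∀ {e} → e ∈ L → Incident w e → other w e ∈ ys) → length (star w L) ≤ length ys
  star-length {L} {w} unique L⊆E into = injection-length (other w) (Unique.filter⁺ (incident? w) unique)
    (λ p q → let (p∈ , w∈p) = ∈-star p ; (q∈ , w∈q) = ∈-star q in
      other-injective (∈-E⁻ (L⊆E p∈)) (∈-E⁻ (L⊆E q∈)) w∈p w∈q)
    (λ p → let (p∈ , w∈p) = ∈-star p in into p∈ w∈p)
    where
    ∈-star : ∀ {e} → e ∈ star w L → e ∈ L × Incident w e
    ∈-star = ∈-filter⁻ (incident? w)

  star-≤n : ∀ {L} w → Unique L → L ⊆ E → length (star w L) ≤ n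
  star-≤n w unique L⊆E = ≤-trans (star-length unique L⊆E (λ _ _ → ∈-allFin _))
    (≤-reflexive (length-tabulate {n = n} id))

  meeting-length : ∀ {L b} e → Unique L → (∀ w → length (star w L) ≤ b) → length (meeting e L) ≤ 2 * b
  meeting-length {L} {b} e@(u , v) unique star≤b = begin
    length (meeting e L)                     ≤⟨ ⊆-length (Unique.filter⁺ (meets? e) unique) (split ∘ ∈-filter⁻ (meets? e)) ⟩
    length (star u L ++ star v L)            ≡⟨ length-++ (star u L) ⟩
    length (star u L) + length (star v L)    ≤⟨ +-mono-≤ (star≤b u) (≤-trans (star≤b v) (≤-reflexive (sym (ℕ.+-identityʳ b)))) ⟩
    2 * b                                    ∎
    where
    open ≤-Reasoning
    split : ∀ {q} → q ∈ L × Meets e q → q ∈ star u L ++ star v L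
    split (q∈ , inj₁ u∈q) = ∈-++⁺ˡ (∈-filter⁺ (incident? u) q∈ u∈q)
    split (q∈ , inj₂ v∈q) = ∈-++⁺ʳ (star u L) (∈-filter⁺ (incident? v) q∈ v∈q)

  -- Colour classes and double counting.

  ∈-class : ∀ {c e} L → e ∈ class c L → e ∈ L × colour e ≡ c
  ∈-class L = ∈-filter⁻ (λ e → colour e ℕ.≟ _) {xs = L}

  class-unique : ∀ {L} c → Unique L → Unique (class c L)
  class-unique c = Unique.filter⁺ (λ e → colour e ℕ.≟ c)

  -- Each edge contributes both of its orientations; `L` and its reversal are disjoint because only
  -- one orientation is increasing.
  darts-length : ∀ {L} {ys : List Pair} → Unique L → L ⊆ E →
    (∀ {e} → e ∈ L → e ∈ ys × swap e ∈ ys) → 2 * length L ≤ length ys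
  darts-length {L} {ys} unique L⊆E both = begin
    2 * length L                    ≡⟨ cong (length L +_) (trans (ℕ.+-identityʳ _) (sym (length-map swap L))) ⟩
    length L + length (map swap L)  ≡⟨ length-++ L ⟨
    length (L ++ map swap L)        ≤⟨ ⊆-length (Unique.++⁺ unique (Unique.map⁺ (cong swap) unique) disjoint) into ⟩
    length ys                       ∎
    where
    open ≤-Reasoning
    disjoint : Disjoint L (map swap L)
    disjoint (e∈ , e∈swap) with ∈-map⁻ swap e∈swap
    ... | _ , q∈ , refl = ℕ.<-asym (proj₁ (∈-E⁻ (L⊆E e∈))) (proj₁ (∈-E⁻ (L⊆E q∈)))
    into : L ++ map swap L ⊆ ys
    into e∈ with ∈-++⁻ L e∈
    ... | inj₁ e∈L = proj₁ (both e∈L)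
    ... | inj₂ e∈swap with ∈-map⁻ swap e∈swap
    ...   | _ , q∈ , refl = proj₂ (both q∈)

  darts : (Fin n → List (Fin n)) → List Pair
  darts N = concatMap (λ v → map (v ,_) (N v)) (allFin n)

  darts-≤ : ∀ {d} N → (∀ v → length (N v) ≤ d) → length (darts N) ≤ n * d
  darts-≤ {d} N N≤d = ≤-trans
    (length-concatMap-≤ _ (allFin n) λ {v} _ → ≤-trans (≤-reflexive (length-map (v ,_) (N v))) (N≤d v))
    (≤-reflexive (cong (_* d) (length-tabulate {n = n} id)))

  ∈-darts : ∀ N {v w} → w ∈ N v → (v , w) ∈ darts N
  ∈-darts N {v} w∈ = ∈-concat⁺′ (∈-map⁺ (v ,_) w∈) (∈-map⁺ _ (∈-allFin v))

  class-size : ℕ → ℕ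
  class-size c = length (class c E)

  class-length-≤ : ∀ {L} c → Unique L → L ⊆ E → length (class c L) ≤ class-size c
  class-length-≤ {L} c unique L⊆E = ⊆-length (class-unique c unique)
    λ e∈ → let (e∈L , eq) = ∈-class L e∈ in ∈-filter⁺ (λ e → colour e ℕ.≟ c) (L⊆E e∈L) eq

  -- The new edge belongs to its own class and is not in `L`. This strictness supplies the spare
  -- index in both kinds of insertion.
  class-∷ : ∀ {e L} → Unique (e ∷ L) → e ∷ L ⊆ E → length (class (colour e) L) < class-size (colour e)
  class-∷ {e} {L} unique e∷L⊆E = ≤-trans
    (≤-reflexive (cong length (sym (filter-accept (λ q → colour q ℕ.≟ colour e) {e} {L} refl))))
    (class-length-≤ (colour e) unique e∷L⊆E)

  -- Classes of distinct colours are disjoint parts of `E`, and twice the number of edges is at most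
  -- the number of ordered pairs of vertices.
  class-sum : ∀ {D x} → Unique D → (∀ {c} → c ∈ D → x ≤ 2 * class-size c) → length D * x ≤ n * n
  class-sum {D} {x} unique x≤ = begin
    length D * x                                 ≤⟨ concatMap-length-≥ (λ c → class c E) D x≤ ⟩
    2 * length classes                           ≤⟨ darts-length classes-unique classes⊆E (λ _ → ∈-all , ∈-all) ⟩
    length (darts (λ _ → allFin n))              ≤⟨ darts-≤ (λ _ → allFin n) (λ _ → ≤-reflexive (length-tabulate {n = n} id)) ⟩
    n * n                                        ∎
    where
    open ≤-Reasoning
    classes = concatMap (λ c → class c E) D
    ∈-all : ∀ {e} → e ∈ darts (λ _ → allFin n)
    ∈-all = ∈-darts (λ _ → allFin n) (∈-allFin _)
    disjoint : ∀ {c d} → c ≢ d → Disjoint (class c E) (class d E)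
    disjoint c≢d (p , q) = c≢d (trans (sym (proj₂ (∈-class E p))) (proj₂ (∈-class E q)))
    classes-unique : Unique classes
    classes-unique = Unique.concat⁺ {xss = map (λ c → class c E) D} (All.map⁺ (All.tabulate λ {c} _ → class-unique c E-unique))
      (AllPairs.map⁺ (AllPairs.map disjoint unique))
    classes⊆E : classes ⊆ E
    classes⊆E e∈ with ∈-concat⁻′ (map (λ c → class c E) D) e∈
    ... | _ , e∈c , c∈ with ∈-map⁻ (λ c → class c E) c∈
    ...   | _ , _ , refl = proj₁ (∈-class E e∈c)

  module _ {t : ℕ} (mon : MonDegAtMost G χ t) where

    -- The handshake lemma in the subgraph of colour `c`, whose degrees are at most `t`. It makes
    -- every colour class fit into `k` matchings.
    2*class-size≤ : ∀ c → 2 * class-size c ≤ t * n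
    2*class-size≤ c = begin
      2 * class-size c                         ≤⟨ darts-length (class-unique c E-unique) (proj₁ ∘ ∈-class E) both ⟩
      length (darts (λ v → neighbours v c))    ≤⟨ darts-≤ (λ v → neighbours v c) (λ v → mon v c) ⟩
      n * t                                    ≡⟨ ℕ.*-comm n t ⟩
      t * n                                    ∎
      where
      open ≤-Reasoning
      both : ∀ {e} → e ∈ class c E → e ∈ darts (λ v → neighbours v c) × swap e ∈ darts (λ v → neighbours v c)
      both {u , v} e∈ with ∈-class E e∈
      ... | e∈E , eq with ∈-E⁻ e∈E
      ...   | _ , edge =
        ∈-darts _ (∈-neighbours edge eq) ,
        ∈-darts _ (∈-neighbours (subst T (SimpleGraph.sym G u v) edge) (trans (sym (colSym χ u v edge)) eq))

    star-class-≤t : ∀ {L} c w → Unique L → L ⊆ E → length (star w (class c L)) ≤ t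
    star-class-≤t {L} c w unique L⊆E = ≤-trans
      (star-length {ys = neighbours w c} (class-unique c unique) (L⊆E ∘ proj₁ ∘ ∈-class L) λ e∈ w∈e →
        let (e∈L , eq) = ∈-class L e∈
            (edge , eq′) = other-adjacent (∈-E⁻ (L⊆E e∈L)) w∈e
        in ∈-neighbours edge (trans eq′ eq))
      (mon w c)

    -- Each of the at most `j` edges in matching `b` has two ends, and each end lies on at most `t`
    -- edges of colour `c`.
    near-length : ∀ {k L j} (f : Pair → Fin k) c b → Unique L → L ⊆ E →
      length (filter (λ q → f q Fin.≟ b) L) ≤ j → length (near f L c b) ≤ j * (2 * t)
    near-length {L = L} f c b unique L⊆E ≤j = ≤-trans
      (length-concatMap-≤ (λ q → meeting q (class c L)) (filter (λ q → f q Fin.≟ b) L) λ {q} _ →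
        meeting-length q (class-unique c unique) (λ w → star-class-≤t c w unique L⊆E))
      (ℕ.*-monoˡ-≤ (2 * t) ≤j)

  -- A rainbow matching has at most one edge of each colour, so `colour` injects it into `D`.
  matching-length : ∀ {k L D} {f : Pair → Fin k} b → Unique L → Proper f L →
    (∀ {e} → e ∈ L → colour e ∈ D) → length (filter (λ q → f q Fin.≟ b) L) ≤ length D
  matching-length {L = L} {f = f} b unique proper into =
    injection-length colour (Unique.filter⁺ (λ q → f q Fin.≟ b) unique) injective
      (into ∘ proj₁ ∘ ∈-filter⁻ (λ q → f q Fin.≟ b) {xs = L})
    where
    injective : ∀ {p q} → p ∈ filter (λ q → f q Fin.≟ b) L → q ∈ filter (λ q → f q Fin.≟ b) L →
      colour p ≡ colour q → p ≡ q
    injective {p} {q} p∈ q∈ eq with p ≟ᴾ q | ∈-filter⁻ (λ q → f q Fin.≟ b) {xs = L} p∈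
                                            | ∈-filter⁻ (λ q → f q Fin.≟ b) {xs = L} q∈
    ... | yes p≡q | _ | _ = p≡q
    ... | no  p≢q | p∈L , fp | q∈L , fq = contradiction (trans fp (sym fq)) (proper p∈L q∈L p≢q (inj₂ eq))

  -- From increasing pairs back to unordered edges.

  norm : Fin n → Fin n → Pair
  norm u v with u Fin.<? v
  ... | yes _ = u , v
  ... | no  _ = v , u

  norm-spec : ∀ u v → norm u v ≡ (u , v) ⊎ norm u v ≡ (v , u)
  norm-spec u v with u Fin.<? v
  ... | yes _ = inj₁ refl
  ... | no  _ = inj₂ refl

  norm-isEdge : ∀ {u v} → Edge G u v → IsEdge (norm u v)
  norm-isEdge {u} {v} edge with u Fin.<? v | Fin.<-cmp u v
  ... | yes u<v | _ = u<v , edge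
  ... | no _ | tri> _ _ v<u = v<u , subst T (SimpleGraph.sym G u v) edge
  ... | no u≮v | tri< u<v _ _ = contradiction u<v u≮v
  ... | no _ | tri≈ _ refl _ = contradiction (subst T (irrefl G u) edge) λ ()

  norm-sym : ∀ u v → norm u v ≡ norm v u
  norm-sym u v with u Fin.<? v | v Fin.<? u | Fin.<-cmp u v
  ... | yes u<v | yes v<u | _ = contradiction v<u (ℕ.<-asym u<v)
  ... | yes _ | no _ | _ = refl
  ... | no _ | yes _ | _ = refl
  ... | no u≮v | no _ | tri< u<v _ _ = contradiction u<v u≮v
  ... | no _ | no v≮u | tri> _ _ v<u = contradiction v<u v≮u
  ... | no _ | no _ | tri≈ _ refl _ = refl

  norm-incidentˡ : ∀ u v → Incident u (norm u v)
  norm-incidentˡ u v with u Fin.<? v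
  ... | yes _ = inj₁ refl
  ... | no  _ = inj₂ refl

  norm-incidentʳ : ∀ u v → Incident v (norm u v)
  norm-incidentʳ u v = subst (Incident v) (norm-sym v u) (norm-incidentˡ v u)

  norm-colour : ∀ {u v} → Edge G u v → colour (norm u v) ≡ col χ u v
  norm-colour {u} {v} edge with u Fin.<? v
  ... | yes _ = refl
  ... | no  _ = sym (colSym χ u v edge)

  norm-injective : ∀ u v x y → norm u v ≡ norm x y → SameEdge u v x y
  norm-injective u v x y eq with norm u v | norm-spec u v | norm x y | norm-spec x y
  norm-injective u v x y refl | _ | inj₁ refl | _ | inj₁ refl = inj₁ (refl , refl)
  norm-injective u v x y refl | _ | inj₁ refl | _ | inj₂ refl = inj₂ (refl , refl)
  norm-injective u v x y refl | _ | inj₂ refl | _ | inj₁ refl = inj₂ (refl , refl)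
  norm-injective u v x y refl | _ | inj₂ refl | _ | inj₂ refl = inj₁ (refl , refl)

  -- Different edges have different representatives, so for two of them in one class `Proper`
  -- excludes a shared end as well as a shared colour.
  decomposition : ∀ {k} {f : Pair → Fin k} → Proper f E → RainbowMatchingDecomposition G χ k
  decomposition {f = f} proper = record
    { cls    = λ u v → f (norm u v)
    ; clsSym = λ u v _ → cong f (norm-sym u v)
    ; rainbowMatching = λ u v x y uv xy same distinct →
        let separate = λ conflict → proper (∈-E⁺ (norm-isEdge uv)) (∈-E⁺ (norm-isEdge xy))
              (distinct ∘ norm-injective u v x y) conflict same
            apart : ∀ {w} → Incident w (norm u v) → ¬ Incident w (norm x y)
            apart = λ w∈p w∈q → separate (inj₁ (meets-at w∈p w∈q))
            u∈ = norm-incidentˡ u v ; v∈ = norm-incidentʳ u v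
            x∈ = norm-incidentˡ x y ; y∈ = norm-incidentʳ x y
        in ( (λ { refl → apart u∈ x∈ }) , (λ { refl → apart u∈ y∈ })
           , (λ { refl → apart v∈ x∈ }) , (λ { refl → apart v∈ y∈ }) )
         , λ eq → separate (inj₂ (trans (norm-colour uv) (trans eq (sym (norm-colour xy)))))
    }

-- Inserting the large colours, then the small ones.

module _ (r n : ℕ) (G : SimpleGraph n) (χ : EdgeColouring G) (mon : MonDegAtMost G χ (11 + r)) where
  open Edges G χ

  private
    k = (11 + r) * n / 2

  Large : ℕ → Set
  Large c = k < 2 * n + class-size c

  large? : Decidable Large
  large? c = k ℕ.<? 2 * n + class-size c

  large-edges small-edges : List Pair
  large-edges = filter (large? ∘ colour) E
  small-edges = filter (¬? ∘ large? ∘ colour) E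

  large-colours : List ℕ
  large-colours = deduplicate ℕ._≟_ (map colour large-edges)

  ∈-large-edges : ∀ {e} → e ∈ large-edges → e ∈ E × Large (colour e)
  ∈-large-edges = ∈-filter⁻ (large? ∘ colour)

  ∈-large-colours : ∀ {e} → e ∈ large-edges → colour e ∈ large-colours
  ∈-large-colours e∈ = ∈-deduplicate⁺ ℕ._≟_ (∈-map⁺ colour e∈)

  large-colours-large : ∀ {c} → c ∈ large-colours → Large c
  large-colours-large c∈ with ∈-map⁻ colour (∈-deduplicate⁻ ℕ._≟_ (map colour large-edges) c∈)
  ... | _ , e∈ , refl = proj₂ (∈-large-edges e∈)

  -- Every large class has more than `(t - 4) n / 2` edges, and the classes share at most `n² / 2`.
  few-large-colours : length large-colours * suc ((7 + r) * n) ≤ n * n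
  few-large-colours = class-sum (deduplicate-! ℕ._≟_ (map colour large-edges))
    λ {c} c∈ → large-class-bound r n (class-size c) (large-colours-large c∈)

  -- While only large colours are present, a matching has at most `j` edges, where `j` is the number
  -- of large colours. Stars have at most `n` edges, so the blocked indices number at most
  -- `2 n + 2 t j`, below `k` by `swap-room`.
  colour-large : Fin k → ∀ L → Unique L → L ⊆ large-edges → ∃ λ (f : Pair → Fin k) → Proper f L
  colour-large i₀ [] _ _ = (λ _ → i₀) , λ ()
  colour-large i₀ (e@(u , _) ∷ L) unique@(_ ∷ unique′) L⊆ with colour-large i₀ L unique′ (L⊆ ∘ there)
  ... | f , proper = insert-swapping proper class<k
    (λ b → near-length mon f (colour e) b unique′ L⊆E
      (matching-length b unique′ proper (∈-large-colours ∘ L⊆ ∘ there)))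
    (ℕ.≤-<-trans (ℕ.+-monoˡ-≤ _ (meeting-length e unique′ (λ w → star-≤n w unique′ L⊆E)))
      -- The end `u` of `e` witnesses `1 ≤ n`, and the colour of `e` witnesses that there is a large
      -- colour.
      (swap-room r n (length large-colours) (ℕ.>-nonZero⁻¹ n ⦃ Fin.nonZeroIndex u ⦄)
        (∈-length (∈-large-colours (L⊆ (here refl)))) few-large-colours))
    where
    L⊆E : L ⊆ E
    L⊆E = proj₁ ∘ ∈-large-edges ∘ L⊆ ∘ there
    class<k : length (class (colour e) L) < k
    class<k = ≤-trans (class-∷ unique (proj₁ ∘ ∈-large-edges ∘ L⊆))
      (2m≤n⇒m≤n/2 (2*class-size≤ mon (colour e)))

  -- For a colour that is not large, `2 n + class-size c ≤ k`, which covers the at most `2 n`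
  -- meeting edges and the rest of the class.
  colour-small : ∀ {L} {f : Pair → Fin k} → Proper f L → ∀ S → Unique (S ++ L) → S ++ L ⊆ E →
    S ⊆ small-edges → ∃ λ (f : Pair → Fin k) → Proper f (S ++ L)
  colour-small {f = f} proper [] _ _ _ = f , proper
  colour-small {L} proper (e ∷ S) unique@(_ ∷ unique′) S++L⊆E S⊆
    with colour-small proper S unique′ (S++L⊆E ∘ there) (S⊆ ∘ there)
  ... | f , proper′ = insert-greedily proper′ (begin-strict
    length (meeting e (S ++ L)) + length (class (colour e) (S ++ L))
      <⟨ ℕ.+-mono-≤-< (meeting-length e unique′ (λ w → star-≤n w unique′ (S++L⊆E ∘ there))) (class-∷ unique S++L⊆E) ⟩
    2 * n + class-size (colour e)
      ≤⟨ ℕ.≮⇒≥ (proj₂ (∈-filter⁻ (¬? ∘ large? ∘ colour) {xs = E} (S⊆ (here refl)))) ⟩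
    k ∎)
    where open ≤-Reasoning

  proper-colouring : Fin k → ∃ λ (f : Pair → Fin k) → Proper f E
  proper-colouring i₀ =
    let (f , proper) = colour-large i₀ large-edges (Unique.filter⁺ (large? ∘ colour) E-unique) id
        (f′ , proper′) = colour-small proper small-edges unique all⊆E id
    in f′ , λ p∈ q∈ → proper′ (E⊆all p∈) (E⊆all q∈)
    where
    unique : Unique (small-edges ++ large-edges)
    unique = Unique.++⁺ (Unique.filter⁺ (¬? ∘ large? ∘ colour) E-unique) (Unique.filter⁺ (large? ∘ colour) E-unique)
      λ (p , q) → proj₂ (∈-filter⁻ (¬? ∘ large? ∘ colour) {xs = E} p) (proj₂ (∈-large-edges q))
    all⊆E : small-edges ++ large-edges ⊆ E
    all⊆E e∈ with ∈-++⁻ small-edges e∈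
    ... | inj₁ p = proj₁ (∈-filter⁻ (¬? ∘ large? ∘ colour) {xs = E} p)
    ... | inj₂ q = proj₁ (∈-large-edges q)
    E⊆all : E ⊆ small-edges ++ large-edges
    E⊆all {e} e∈ with large? (colour e)
    ... | yes large = ∈-++⁺ʳ small-edges (∈-filter⁺ (large? ∘ colour) e∈ large)
    ... | no ¬large = ∈-++⁺ˡ (∈-filter⁺ (¬? ∘ large? ∘ colour) e∈ ¬large)

theorem1p3 : (t : ℕ) → 11 ≤ t → (n : ℕ) → (G : SimpleGraph n) →
    (χ : EdgeColouring G) → MonDegAtMost G χ t →
    RainbowMatchingDecomposition G χ ((t * n) / 2)
-- Here `k` is zero and no initial index exists, but there are no vertices either.
theorem1p3 t 11≤t zero G χ mon = record { cls = λ () ; clsSym = λ () ; rainbowMatching = λ () }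
theorem1p3 t 11≤t n@(suc _) G χ mon with ℕ.m≤n⇒∃[o]m+o≡n 11≤t
... | r , refl = Edges.decomposition G χ (proj₂ (proper-colouring r n G χ mon (Fin.fromℕ< k>0)))
  where
  k>0 : 0 < (11 + r) * n / 2
  -- Since `t ≥ 2` and `n ≥ 1`, the product `t n` is at least 2; this provides the initial index.
  k>0 = m≥n⇒m/n>0 {(11 + r) * n} {2} (ℕ.*-mono-≤ {2} {11 + r} {1} {n} (s≤s (s≤s z≤n)) (s≤s z≤n))
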